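{- Let $h\ge 1$ and $r\ge 1$ be integers, let $P$ be a path, let $H$ be a graph, and let $G$ be a graph such that $G \subseteq P^h \boxtimes K_r \boxtimes H$. Then $\operatorname{tn}(G) \leq (2h+1)\cdot r\cdot \operatorname{tn}(H)$.
   Context: All graphs are finite and simple. $G\subseteq X$ means that $G$ is (isomorphic to) a subgraph of $X$. $K_r$ is the complete graph on $r$ vertices. For $i\ge 1$, the $i$-th power $X^i$ of a graph $X$ is the graph on the same vertex set in which two distinct vertices are adjacent if and only if their distance in $X$ is at most $i$. The strong product $X\boxtimes Y$ has vertex set $V(X)\times V(Y)$; distinct vertices $\langle x,y\rangle$ and $\langle x',y'\rangle$ are adjacent if and only if (a) $x=x'$ and $yy'\in E(Y)$, or (b) $y=y'$ and $xx'\in E(X)$, or (c) $xx'\in E(X)$ and $yy'\in E(Y)$. A $t$-track assignment of a graph $G$ is a partition of $V(G)$ into $t$ independent sets $V_1,\dots,V_t$ (tracks), each equipped with a total order $\prec_i$. An X-crossing consists of two edges $(u,v)$ and $(u',v')$ with $u,u'\in V_i$, $v,v'\in V_j$, $i\ne j$, $u\prec_i u'$ and $v'\prec_j v$. A $t$-track layout is a $t$-track assignment with no X-crossing. The track number $\operatorname{tn}(G)$ is the minimum $t$ such that $G$ has a $t$-track layout. -}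

module Defs where

open import Axiom.UniquenessOfIdentityProofs using (module Decidable⇒UIP)
open import Data.Bool using (Bool; true; false; T; T?)
open import Data.Empty using (⊥; ⊥-elim)
open import Data.Fin as Fin using (Fin; toℕ)
import Data.Fin.Properties as Fin
open import Data.Nat using (ℕ; zero; suc; _+_; _*_; _≤_; _≟_; s≤s; z≤n)
open import Data.Nat.Properties using (≤-refl; ≤-trans; n≤1+n; m≤n⇒m<n∨m≡n; ≰⇒>; 1+n≢n)
open import Data.Product using (Σ; ∃; ∃-syntax; _×_; _,_; proj₁; proj₂)
open import Data.Product.Function.NonDependent.Propositional using (_×-↔_)
open import Data.Sum using (_⊎_; inj₁; inj₂; swap)
open import Data.Vec using (Vec; []; _∷_; lookup; tabulate)
open import Data.Vec.Properties using (lookup∘tabulate)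
open import Function using (_∘_; _↔_; _⇔_; Inverse; Injection; Injective)
open import Function.Properties.Inverse using (↔-refl; ↔-sym; ↔-trans; ↔⇒↣)
open import Level using (Level; 0ℓ)
open import Relation.Binary
  using (Rel; Decidable; DecidableEquality; Symmetric; IsStrictTotalOrder; Tri; tri<; tri≈; tri>)
open import Relation.Binary.PropositionalEquality
  using (_≡_; _≢_; refl; sym; trans; cong; subst; isEquivalence; ≢-sym)
open import Relation.Nullary using (¬_; Dec; yes; no; isYes; ¬?; _×-dec_; _⊎-dec_; _→-dec_)
open import Relation.Nullary.Decidable using (map′; toWitness; fromWitness)
import Relation.Unary as U

private
  variable
    ℓ : Level

module _ {n : ℕ} where
  open Decidable⇒UIP (Fin._≟_ {n}) using (≡-irrelevant) public

IsLeast : (ℕ → Set ℓ) → ℕ → Set ℓ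
IsLeast P m = P m × (∀ k → P k → m ≤ k)

leastUpTo : {P : ℕ → Set ℓ} → U.Decidable P → ∀ n →
            (∃[ m ] IsLeast P m × m ≤ n) ⊎ (∀ k → k ≤ n → ¬ P k)
leastUpTo P? zero with P? 0
... | yes p = inj₁ (0 , (p , λ _ _ → z≤n) , z≤n)
... | no ¬p = inj₂ λ { zero _ → ¬p }
leastUpTo {P = P} P? (suc n) with leastUpTo P? n
... | inj₁ (m , least , m≤n) = inj₁ (m , least , ≤-trans m≤n (n≤1+n n))
... | inj₂ none with P? (suc n)
...   | yes p = inj₁ (suc n , (p , λ k pk → ≰⇒> λ k≤n → none k k≤n pk) , ≤-refl)
...   | no ¬p = inj₂ none′
  where
  none′ : ∀ k → k ≤ suc n → ¬ P k
  none′ k k≤1+n with m≤n⇒m<n∨m≡n k≤1+n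
  ... | inj₁ (s≤s k≤n) = none k k≤n
  ... | inj₂ refl      = ¬p

least : {P : ℕ → Set ℓ} → U.Decidable P → ∀ n → P n → ∃ (IsLeast P)
least P? n p with leastUpTo P? n
... | inj₁ (m , least , _) = m , least
... | inj₂ none = ⊥-elim (none n ≤-refl p)

-- Decidability of adjacency is automatic classically.
record Graph : Set₁ where
  field
    V      : Set
    size   : ℕ
    finite : V ↔ Fin size
    E      : Rel V 0ℓ
    E?     : Decidable E
    E-sym  : Symmetric E
    E-irr  : ∀ {v} → ¬ E v v

  open Inverse finite public using () renaming (to to index; from to vertex)

  vertex-index : ∀ v → vertex (index v) ≡ v
  vertex-index v = Inverse.strictlyInverseʳ finite v

  _≟ⱽ_ : DecidableEquality V
  _≟ⱽ_ = Fin.inj⇒≟ (↔⇒↣ finite)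

  any? : {P : V → Set ℓ} → U.Decidable P → Dec (∃ P)
  any? {P = P} P? = map′
    (λ (i , p) → vertex i , p)
    (λ (v , p) → index v , subst P (sym (vertex-index v)) p)
    (Fin.any? (P? ∘ vertex))

  all? : {P : V → Set ℓ} → U.Decidable P → Dec (∀ v → P v)
  all? {P = P} P? = map′
    (λ f v → subst P (vertex-index v) (f (index v)))
    (λ f i → f (vertex i))
    (Fin.all? (P? ∘ vertex))

open Graph using (V; E)

infix 4 _⊆_ _≅_

record _⊆_ (G X : Graph) : Set where
  field
    to        : V G → V X
    injective : Injective _≡_ _≡_ to
    preserves : ∀ {u v} → E G u v → E X (to u) (to v)

record _≅_ (G X : Graph) : Set where
  field
    bijection : V G ↔ V X
  open Inverse bijection public using (to; from)
  field
    edges : ∀ {u v} → E G u v ⇔ E X (to u) (to v)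

K : ℕ → Graph
K r = record
  { V      = Fin r
  ; size   = r
  ; finite = ↔-refl
  ; E      = _≢_
  ; E?     = λ i j → ¬? (i Fin.≟ j)
  ; E-sym  = ≢-sym
  ; E-irr  = λ i≢i → i≢i refl
  }

pathGraph : ℕ → Graph
pathGraph n = record
  { V      = Fin n
  ; size   = n
  ; finite = ↔-refl
  ; E      = λ i j → toℕ j ≡ suc (toℕ i) ⊎ toℕ i ≡ suc (toℕ j)
  ; E?     = λ i j → (toℕ j ≟ suc (toℕ i)) ⊎-dec (toℕ i ≟ suc (toℕ j))
  ; E-sym  = swap
  ; E-irr  = λ { (inj₁ eq) → 1+n≢n (sym eq) ; (inj₂ eq) → 1+n≢n (sym eq) }
  }

IsPath : Graph → Set
IsPath P = ∃[ n ] P ≅ pathGraph (suc n)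

module _ (X : Graph) where

  open Graph X using (E?; E-sym; any?; _≟ⱽ_)

  data Walk : ℕ → Rel (V X) 0ℓ where
    []  : ∀ {u} → Walk 0 u u
    _∷_ : ∀ {k u v w} → E X u v → Walk k v w → Walk (suc k) u w

  -- No d satisfies IsDistance u v d when u and v lie in different components.
  IsDistance : V X → V X → ℕ → Set
  IsDistance u v = IsLeast (λ k → Walk k u v)

  Walk? : ∀ k → Decidable (Walk k)
  Walk? zero    u v = map′ (λ { refl → [] }) (λ { [] → refl }) (u ≟ⱽ v)
  Walk? (suc k) u w = map′ (λ (_ , e , p) → e ∷ p) (λ { (e ∷ p) → _ , e , p })
                           (any? λ v → E? u v ×-dec Walk? k v w)

  snoc : ∀ {k u v w} → Walk k u v → E X v w → Walk (suc k) u w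
  snoc []      e = e ∷ []
  snoc (d ∷ p) e = d ∷ snoc p e

  reverse : ∀ {k u v} → Walk k u v → Walk k v u
  reverse []      = []
  reverse (e ∷ p) = snoc (reverse p) (E-sym e)

  IsDistance-sym : ∀ {u v d} → IsDistance u v d → IsDistance v u d
  IsDistance-sym (p , min) = reverse p , λ k q → min k (reverse q)

  Distance≤ : ℕ → Rel (V X) 0ℓ
  Distance≤ i u v = ∃[ d ] IsDistance u v d × d ≤ i

  Distance≤? : ∀ i → Decidable (Distance≤ i)
  Distance≤? i u v with leastUpTo (λ k → Walk? k u v) i
  ... | inj₁ within = yes within
  ... | inj₂ none   = no λ (d , (p , _) , d≤i) → none d d≤i p

infix 8 _^_

_^_ : Graph → ℕ → Graph
X ^ i = record
  { V      = V X
  ; size   = size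
  ; finite = finite
  ; E      = λ u v → u ≢ v × Distance≤ X i u v
  ; E?     = λ u v → ¬? (u ≟ⱽ v) ×-dec Distance≤? X i u v
  ; E-sym  = λ (u≢v , d , dist , d≤i) → ≢-sym u≢v , d , IsDistance-sym X dist , d≤i
  ; E-irr  = λ (v≢v , _) → v≢v refl
  }
  where open Graph X using (size; finite; _≟ⱽ_)

infixl 7 _⊠_

_⊠_ : Graph → Graph → Graph
X ⊠ Y = record
  { V      = V X × V Y
  ; size   = X.size * Y.size
  ; finite = ↔-trans (X.finite ×-↔ Y.finite) (↔-sym Fin.*↔×)
  ; E      = λ (x , y) (x′ , y′) →
               (x ≡ x′ × Y.E y y′) ⊎ (y ≡ y′ × X.E x x′) ⊎ (X.E x x′ × Y.E y y′)
  ; E?     = λ (x , y) (x′ , y′) →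
               ((x X.≟ⱽ x′) ×-dec Y.E? y y′) ⊎-dec
               (((y Y.≟ⱽ y′) ×-dec X.E? x x′) ⊎-dec (X.E? x x′ ×-dec Y.E? y y′))
  ; E-sym  = λ { (inj₁ (eq , e))        → inj₁ (sym eq , Y.E-sym e)
               ; (inj₂ (inj₁ (eq , e))) → inj₂ (inj₁ (sym eq , X.E-sym e))
               ; (inj₂ (inj₂ (d , e)))  → inj₂ (inj₂ (X.E-sym d , Y.E-sym e)) }
  ; E-irr  = λ { (inj₁ (_ , e))        → Y.E-irr e
               ; (inj₂ (inj₁ (_ , e))) → X.E-irr e
               ; (inj₂ (inj₂ (d , _))) → X.E-irr d }
  }
  where
  module X = Graph X
  module Y = Graph Y

-- Tracks may be empty; this does not affect the minimum number of tracks.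
record TrackAssignment (G : Graph) (t : ℕ) : Set₁ where
  field
    track       : V G → Fin t
    independent : ∀ {u v} → E G u v → track u ≢ track v

  Track : Fin t → Set
  Track i = ∃[ v ] track v ≡ i

  field
    _≺_   : ∀ {i} → Rel (Track i) 0ℓ
    order : ∀ i → IsStrictTotalOrder _≡_ (_≺_ {i})

record XCrossing {G : Graph} {t : ℕ} (A : TrackAssignment G t) : Set where
  open TrackAssignment A
  field
    {i j}  : Fin t
    i≢j    : i ≢ j
    u u′   : Track i
    v v′   : Track j
    uv     : E G (proj₁ u) (proj₁ v)
    u′v′   : E G (proj₁ u′) (proj₁ v′)
    u≺u′   : u ≺ u′
    v′≺v   : v′ ≺ v

TrackLayout : Graph → ℕ → Set₁
TrackLayout G t = Σ (TrackAssignment G t) λ A → ¬ XCrossing A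

trivialLayout : ∀ G → TrackLayout G (Graph.size G)
trivialLayout G = assignment , λ c → XCrossing.u≺u′ c
  where
  open Graph G using (index; finite; E-irr)

  index-injective : Injective _≡_ _≡_ index
  index-injective = Injection.injective (↔⇒↣ finite)

  unique : ∀ {i} (x y : ∃[ v ] index v ≡ i) → x ≡ y
  unique (u , refl) (v , q) with index-injective q
  ... | refl = cong (u ,_) (≡-irrelevant refl q)

  assignment : TrackAssignment G (Graph.size G)
  assignment = record
    { track       = index
    ; independent = λ {u} e eq → E-irr (subst (E G u) (sym (index-injective eq)) e)
    ; _≺_         = λ _ _ → ⊥
    ; order       = λ _ → record
      { isStrictPartialOrder = record
        { isEquivalence = isEquivalence
        ; irrefl        = λ _ ()
        ; trans         = λ ()
        ; <-resp-≈      = (λ _ ()) , (λ _ ())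
        }
      ; compare = λ x y → tri≈ (λ ()) (unique x y) (λ ())
      }
    }

vec-any? : {A : Set} → (∀ {ℓ} {P : A → Set ℓ} → U.Decidable P → Dec (∃ P)) →
           ∀ {n} {P : Vec A n → Set ℓ} → U.Decidable P → Dec (∃ P)
vec-any? any? {zero}  P? = map′ ([] ,_) (λ { ([] , p) → p }) (P? [])
vec-any? any? {suc n} P? =
  map′ (λ (x , xs , p) → x ∷ xs , p) (λ { (x ∷ xs , p) → x , xs , p })
       (any? λ x → vec-any? any? λ xs → P? (x ∷ xs))

bool-any? : {P : Bool → Set ℓ} → U.Decidable P → Dec (∃ P)
bool-any? P? =
  map′ (λ { (inj₁ p) → true , p ; (inj₂ p) → false , p })
       (λ { (true , p) → inj₁ p ; (false , p) → inj₂ p })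
       (P? true ⊎-dec P? false)

-- Existence of a t-track layout is decided by searching all maps V G → Fin t and all
-- Boolean relations on V G; `Valid` says such a pair describes a layout.
module _ (G : Graph) (t : ℕ) where

  open Graph G using (index; vertex; vertex-index; size; E?; _≟ⱽ_; all?)

  record Valid (c : V G → Fin t) (R : V G → V G → Bool) : Set where
    constructor valid
    field
      indep  : ∀ u v → E G u v → c u ≢ c v
      irr    : ∀ u → ¬ T (R u u)
      total  : ∀ u v → c u ≡ c v → T (R u v) ⊎ u ≡ v ⊎ T (R v u)
      transR : ∀ u v w → c u ≡ c v → c v ≡ c w → T (R u v) → T (R v w) → T (R u w)
      noX    : ∀ u u′ v v′ → c u ≡ c u′ → c v ≡ c v′ → c u ≢ c v →
               E G u v → E G u′ v′ → T (R u u′) → ¬ T (R v′ v)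

  Valid? : ∀ c R → Dec (Valid c R)
  Valid? c R = map′
    (λ (a , b , d , e , f) → valid a b d e f)
    (λ (valid a b d e f) → a , b , d , e , f)
    ( all? (λ u → all? λ v → E? u v →-dec ¬? (c u Fin.≟ c v))
    ×-dec all? (λ u → ¬? (T? (R u u)))
    ×-dec all? (λ u → all? λ v →
            (c u Fin.≟ c v) →-dec (T? (R u v) ⊎-dec ((u ≟ⱽ v) ⊎-dec T? (R v u))))
    ×-dec all? (λ u → all? λ v → all? λ w →
            (c u Fin.≟ c v) →-dec ((c v Fin.≟ c w) →-dec
            (T? (R u v) →-dec (T? (R v w) →-dec T? (R u w)))))
    ×-dec all? (λ u → all? λ u′ → all? λ v → all? λ v′ →
            (c u Fin.≟ c u′) →-dec ((c v Fin.≟ c v′) →-dec (¬? (c u Fin.≟ c v) →-dec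
            (E? u v →-dec (E? u′ v′ →-dec (T? (R u u′) →-dec ¬? (T? (R v′ v)))))))))

  Valid-resp : ∀ {c c′ R R′} → (∀ v → c v ≡ c′ v) → (∀ u v → R u v ≡ R′ u v) →
               Valid c R → Valid c′ R′
  Valid-resp {c} {c′} {R} {R′} c≗ R≗ (valid indep irr total transR noX) = valid
    (λ u v e eq → indep u v e (c← eq))
    (λ u r → irr u (R← r))
    (λ u v eq → total′ (total u v (c← eq)))
    (λ u v w p q r s → R→ (transR u v w (c← p) (c← q) (R← r) (R← s)))
    (λ u u′ v v′ p q n d e r s →
       noX u u′ v v′ (c← p) (c← q) (λ eq → n (c→ eq)) d e (R← r) (R← s))
    where
    c← : ∀ {u v} → c′ u ≡ c′ v → c u ≡ c v
    c← {u} {v} eq = trans (c≗ u) (trans eq (sym (c≗ v)))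
    c→ : ∀ {u v} → c u ≡ c v → c′ u ≡ c′ v
    c→ {u} {v} eq = trans (sym (c≗ u)) (trans eq (c≗ v))
    R← : ∀ {u v} → T (R′ u v) → T (R u v)
    R← {u} {v} = subst T (sym (R≗ u v))
    R→ : ∀ {u v} → T (R u v) → T (R′ u v)
    R→ {u} {v} = subst T (R≗ u v)
    total′ : ∀ {u v} → T (R u v) ⊎ u ≡ v ⊎ T (R v u) → T (R′ u v) ⊎ u ≡ v ⊎ T (R′ v u)
    total′ (inj₁ r)        = inj₁ (R→ r)
    total′ (inj₂ (inj₁ p)) = inj₂ (inj₁ p)
    total′ (inj₂ (inj₂ r)) = inj₂ (inj₂ (R→ r))

  Valid⇒Layout : ∀ {c R} → Valid c R → TrackLayout G t
  Valid⇒Layout {c} {R} (valid indep irr total transR noX) = assignment , noCrossing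
    where
    _≺_ : ∀ {i} → Rel (∃[ v ] c v ≡ i) 0ℓ
    (u , _) ≺ (v , _) = T (R u v)

    compare : ∀ {i} (x y : ∃[ v ] c v ≡ i) → Tri (x ≺ y) (x ≡ y) (y ≺ x)
    compare (u , p) (v , q) with total u v (trans p (sym q))
    ... | inj₁ r = tri< r (λ { refl → irr u r })
                          (λ s → irr u (transR u v u (trans p (sym q)) (trans q (sym p)) r s))
    ... | inj₂ (inj₁ refl) = tri≈ (irr u) (cong (u ,_) (≡-irrelevant p q)) (irr u)
    ... | inj₂ (inj₂ r) = tri> (λ s → irr u (transR u v u (trans p (sym q)) (trans q (sym p)) s r))
                               (λ { refl → irr u r }) r

    assignment : TrackAssignment G t
    assignment = record
      { track       = c
      ; independent = indep _ _
      ; _≺_         = _≺_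
      ; order       = λ _ → record
        { isStrictPartialOrder = record
          { isEquivalence = isEquivalence
          ; irrefl        = λ { {u , _} refl r → irr u r }
          ; trans         = λ { {u , p} {v , q} {w , s} →
                                transR u v w (trans p (sym q)) (trans q (sym s)) }
          ; <-resp-≈      = (λ { refl r → r }) , (λ { refl r → r })
          }
        ; compare = compare
        }
      }

    noCrossing : ¬ XCrossing assignment
    noCrossing X with XCrossing.u X | XCrossing.u′ X | XCrossing.v X | XCrossing.v′ X
                    | XCrossing.i≢j X | XCrossing.uv X | XCrossing.u′v′ X
                    | XCrossing.u≺u′ X | XCrossing.v′≺v X
    ... | u , p | u′ , p′ | v , q | v′ , q′ | i≢j | d | e | r | s =
      noX u u′ v v′ (trans p (sym p′)) (trans q (sym q′))
          (λ eq → i≢j (trans (sym p) (trans eq q))) d e r s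

  Layout⇒Valid : TrackLayout G t → ∃[ c ] ∃[ R ] Valid c R
  Layout⇒Valid (A , noCrossing) = track , (λ u v → isYes (≺? u v)) , valid
    (λ _ _ → independent)
    (λ u r → let p , q = R→ r in irrefl (cong (u ,_) (≡-irrelevant p refl)) q)
    total
    (λ u v w _ _ r s →
       let p , a = R→ r ; q , b = R→ s
       in R← (trans p q) (<-trans (move p q a) b))
    (λ u u′ v v′ _ _ n d e r s →
       let p , a = R→ r ; q , b = R→ s
       in noCrossing record
            { i≢j  = λ eq → n (trans p eq)
            ; u    = u , p
            ; u′   = u′ , refl
            ; v    = v , refl
            ; v′   = v′ , q
            ; uv   = d
            ; u′v′ = e
            ; u≺u′ = a
            ; v′≺v = b
            })
    where
    open TrackAssignment A
    module Order {i} = IsStrictTotalOrder (order i)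
    open Order using (irrefl; compare; _<?_) renaming (trans to <-trans)

    Below : V G → V G → Set
    Below u v = Σ (track u ≡ track v) λ p → (u , p) ≺ (v , refl)

    ≺? : ∀ u v → Dec (Below u v)
    ≺? u v with track u Fin.≟ track v
    ... | no ¬p = no (¬p ∘ proj₁)
    ... | yes p = map′ (p ,_)
      (λ (q , r) → subst (λ z → (u , z) ≺ (v , refl)) (≡-irrelevant q p) r)
      ((u , p) <? (v , refl))

    R→ : ∀ {u v} → T (isYes (≺? u v)) → Below u v
    R→ {u} {v} = toWitness {a? = ≺? u v}

    R← : ∀ {u v} (p : track u ≡ track v) → (u , p) ≺ (v , refl) → T (isYes (≺? u v))
    R← {u} {v} p r = fromWitness {a? = ≺? u v} (p , r)

    move : ∀ {u v i} (p : track u ≡ track v) (q : track v ≡ i) →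
           (u , p) ≺ (v , refl) → (u , trans p q) ≺ (v , q)
    move p refl r = subst (λ z → (_ , z) ≺ (_ , refl)) (≡-irrelevant p (trans p refl)) r

    flip : ∀ {u v i} (p : track u ≡ i) (q : track v ≡ i) →
           (v , q) ≺ (u , p) → (v , trans q (sym p)) ≺ (u , refl)
    flip refl q r = subst (λ z → (_ , z) ≺ (_ , refl)) (≡-irrelevant q (trans q refl)) r

    total : ∀ u v → track u ≡ track v →
            T (isYes (≺? u v)) ⊎ u ≡ v ⊎ T (isYes (≺? v u))
    total u v p with compare (u , p) (v , refl)
    ... | tri< r _ _  = inj₁ (R← p r)
    ... | tri≈ _ eq _ = inj₂ (inj₁ (cong proj₁ eq))
    ... | tri> _ _ r  = inj₂ (inj₂ (R← (sym p) (flip p refl r)))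

  TrackLayout? : Dec (TrackLayout G t)
  TrackLayout? = map′
    (λ (_ , _ , ok) → Valid⇒Layout ok)
    (λ L → let c , R , ok = Layout⇒Valid L in
      tabulate (c ∘ vertex) , tabulate (λ i → tabulate (R (vertex i) ∘ vertex)) ,
      Valid-resp (λ v → sym (decode-tabulate c v))
                 (λ u v → sym (decode₂-tabulate R u v)) ok)
    (vec-any? Fin.any? λ cs → vec-any? (vec-any? bool-any?) λ Rs →
      Valid? (decode cs) (λ u v → decode (decode Rs u) v))
    where
    decode : {A : Set} → Vec A size → V G → A
    decode xs v = lookup xs (index v)

    decode-tabulate : {A : Set} (f : V G → A) → ∀ v → decode (tabulate (f ∘ vertex)) v ≡ f v
    decode-tabulate f v = trans (lookup∘tabulate (f ∘ vertex) (index v)) (cong f (vertex-index v))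

    decode₂-tabulate : {A : Set} (R : V G → V G → A) → ∀ u v →
      decode (decode (tabulate (λ i → tabulate (R (vertex i) ∘ vertex))) u) v ≡ R u v
    decode₂-tabulate R u v = trans
      (cong (λ xs → decode xs v) (decode-tabulate (λ u → tabulate (R u ∘ vertex)) u))
      (decode-tabulate (R u) v)

trackNumber : ∀ G → ∃ (IsLeast (TrackLayout G))
trackNumber G = least (TrackLayout? G) (Graph.size G) (trivialLayout G)

tn : Graph → ℕ
tn G = proj₁ (trackNumber G)

tn-isLeast : ∀ G → IsLeast (TrackLayout G) (tn G)
tn-isLeast G = proj₂ (trackNumber G)

{-# OPTIONS --safe #-}

-- Give (p, k, x) the track (position of p mod 2h+1, k, track of x), ordered by the position of p
-- and then by the order of x.  The endpoints of an edge have positions differing by at most h,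
-- so the residues of these positions determine their difference.  Hence in an X-crossing both
-- edges have the same displacement along P, which forces p = p′ and q = q′, and what remains is
-- an X-crossing in H or two incompatible comparisons in H.
module Submission where

open import Defs
open import Data.Bool using (Bool; T; T?)
open import Data.Fin as Fin using (Fin; toℕ; combine)
import Data.Fin.Properties as Fin
open import Data.Nat using (ℕ; suc; _+_; _*_; _≤_; _<_; _≟_; _<?_; NonZero; >-nonZero)
open import Data.Nat.DivMod using (_/_; _%_; _mod_; m≡m%n+[m/n]*n; m%n<n; %-distribˡ-+)
open import Data.Nat.Properties
open import Algebra.Properties.CommutativeSemigroup +-commutativeSemigroup using (interchange)
open import Data.Product using (∃-syntax; _×_; _,_; proj₁; proj₂; swap)
open import Data.Sum using (_⊎_; inj₁; inj₂)
open import Data.Empty using (⊥-elim)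
open import Function using (_∘_; Injective; Injection; Equivalence)
open import Function.Properties.Inverse using (↔⇒↣)
open import Relation.Binary using (tri<; tri≈; tri>)
open import Relation.Binary.PropositionalEquality
  using (_≡_; _≢_; refl; sym; trans; cong; cong₂; subst)
open import Relation.Nullary using (¬_; Dec; yes; no; isYes; _×-dec_; _⊎-dec_)
open import Relation.Nullary.Decidable using (toWitness; fromWitness)

open Graph using (V; E)

-- Bounded differences of natural numbers, free of truncated subtraction.

Close : ℕ → ℕ → ℕ → Set
Close n a b = a ≤ b + n × b ≤ a + n

close-refl : ∀ {n a} → Close n a a
close-refl = m≤m+n _ _ , m≤m+n _ _

close-+ : ∀ {m n a b c d} → Close m a b → Close n c d → Close (m + n) (a + c) (b + d)
close-+ {m} {n} {a} {b} {c} {d} (a≤ , b≤) (c≤ , d≤) = add b d a≤ c≤ , add a c b≤ d≤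
  where
  add : ∀ {a c} b d → a ≤ b + m → c ≤ d + n → a + c ≤ b + d + (m + n)
  add {a} {c} b d p q = begin
    a + c             ≤⟨ +-mono-≤ p q ⟩
    b + m + (d + n)   ≡⟨ interchange b m d n ⟩
    b + d + (m + n)   ∎
    where open ≤-Reasoning

close-trans : ∀ {m n a b c} → Close m a b → Close n b c → Close (m + n) a c
close-trans {m} {n} {a} {b} {c} (a≤ , b≤) (b≤′ , c≤) =
  subst (a ≤_) (trans (+-assoc c n m) (cong (c +_) (+-comm n m))) (≤-trans a≤ (+-monoˡ-≤ m b≤′)) ,
  subst (c ≤_) (+-assoc a m n) (≤-trans c≤ (+-monoˡ-≤ n b≤))

close-mono : ∀ {m n a b} → m ≤ n → Close m a b → Close n a b
close-mono {a = a} {b} m≤n (p , q) =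
  ≤-trans p (+-monoʳ-≤ b m≤n) , ≤-trans q (+-monoʳ-≤ a m≤n)

-- Residues determine numbers at small distance.

module _ {d : ℕ} .{{_ : NonZero d}} where

  quotient-gap : ∀ {a b} → a % d ≡ b % d → a / d < b / d → a + d ≤ b
  quotient-gap {a} {b} a≡b a/d<b/d = begin
    a + d                      ≡⟨ cong (_+ d) (m≡m%n+[m/n]*n a d) ⟩
    a % d + a / d * d + d      ≡⟨ +-assoc (a % d) (a / d * d) d ⟩
    a % d + (a / d * d + d)    ≡⟨ cong₂ _+_ a≡b (+-comm (a / d * d) d) ⟩
    b % d + suc (a / d) * d    ≤⟨ +-monoʳ-≤ (b % d) (*-monoˡ-≤ d a/d<b/d) ⟩
    b % d + b / d * d          ≡⟨ m≡m%n+[m/n]*n b d ⟨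
    b                          ∎
    where open ≤-Reasoning

  -- With equal residues, different quotients would put `a` and `b` at least `d` apart, and `d`
  -- exceeds `n`.
  close-%⇒≡ : ∀ {n a b} → n < d → a % d ≡ b % d → Close n a b → a ≡ b
  close-%⇒≡ {n} {a} {b} n<d a≡b (a≤ , b≤) with <-cmp (a / d) (b / d)
  ... | tri< lt _ _ =
    ⊥-elim (<⇒≱ (+-monoʳ-< a n<d) (≤-trans (quotient-gap a≡b lt) b≤))
  ... | tri> _ _ gt =
    ⊥-elim (<⇒≱ (+-monoʳ-< b n<d) (≤-trans (quotient-gap (sym a≡b) gt) a≤))
  ... | tri≈ _ eq _ = trans (m≡m%n+[m/n]*n a d)
    (trans (cong₂ (λ r q → r + q * d) a≡b eq) (sym (m≡m%n+[m/n]*n b d)))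

  %-cong-+ : ∀ {a a′ b b′} → a % d ≡ a′ % d → b % d ≡ b′ % d → (a + b) % d ≡ (a′ + b′) % d
  %-cong-+ {a} {a′} {b} {b′} p q = trans (%-distribˡ-+ a b d)
    (trans (cong₂ (λ x y → (x + y) % d) p q) (sym (%-distribˡ-+ a′ b′ d)))

  mod-injective : ∀ {a b} → a mod d ≡ b mod d → a % d ≡ b % d
  mod-injective {a} {b} = Fin.fromℕ<-injective (a % d) (b % d) (m%n<n a d) (m%n<n b d)

-- Restricting a layout to a subgraph.

Valid-⊆ : ∀ {G X t c R} (G⊆X : G ⊆ X) → let open _⊆_ G⊆X in
          Valid X t c R → Valid G t (c ∘ to) (λ u v → R (to u) (to v))
Valid-⊆ {c = c} {R} G⊆X (valid indep irr total transR noX) = valid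
  (λ u v e → indep (to u) (to v) (preserves e))
  (λ u → irr (to u))
  total′
  (λ u v w → transR (to u) (to v) (to w))
  (λ u u′ v v′ p q n d e → noX (to u) (to u′) (to v) (to v′) p q n (preserves d) (preserves e))
  where
  open _⊆_ G⊆X
  total′ : ∀ u v → c (to u) ≡ c (to v) → T (R (to u) (to v)) ⊎ u ≡ v ⊎ T (R (to v) (to u))
  total′ u v p with total (to u) (to v) p
  ... | inj₁ r         = inj₁ r
  -- Injectivity keeps distinct vertices of a track comparable: they cannot share an image.
  ... | inj₂ (inj₁ eq) = inj₂ (inj₁ (injective eq))
  ... | inj₂ (inj₂ r)  = inj₂ (inj₂ r)

-- Layout of the product when `Q` has bandwidth at most `h`, witnessed by `pos`.

module _ {Q H : Graph} {h r t d : ℕ} .{{_ : NonZero d}} (2h<d : h + h < d)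
         (pos : V Q → ℕ) (pos-injective : Injective _≡_ _≡_ pos)
         (pos-close : ∀ {p q} → E Q p q → Close h (pos p) (pos q))
         {c : V H → Fin t} {R : V H → V H → Bool} (ok : Valid H t c R) where

  private
    open Valid ok

    X : Graph
    X = Q ⊠ K r ⊠ H

    level : V X → ℕ
    level ((p , _) , _) = pos p

    track : V X → Fin (d * r * t)
    track ((p , k) , x) = combine (combine (pos p mod d) k) (c x)

    track-injective : ∀ {u v} → track u ≡ track v →
      level u % d ≡ level v % d × proj₂ (proj₁ u) ≡ proj₂ (proj₁ v) × c (proj₂ u) ≡ c (proj₂ v)
    track-injective {(p , k) , x} {(q , l) , y} eq =
      let eq₁ , x≡y = Fin.combine-injective (combine (pos p mod d) k) (c x)
                                            (combine (pos q mod d) l) (c y) eq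
          p≡q , k≡l = Fin.combine-injective (pos p mod d) k (pos q mod d) l eq₁
      in mod-injective p≡q , k≡l , x≡y

    -- The `K r` coordinate is constant on each track, so position and then `R` already separate the
    -- vertices of a track.
    Below : V X → V X → Set
    Below u v = level u < level v ⊎ (level u ≡ level v × T (R (proj₂ u) (proj₂ v)))

    below? : ∀ u v → Dec (Below u v)
    below? u v = (level u <? level v) ⊎-dec
                 ((level u ≟ level v) ×-dec T? (R (proj₂ u) (proj₂ v)))

    rel : V X → V X → Bool
    rel u v = isYes (below? u v)

    rel⇒Below : ∀ {u v} → T (rel u v) → Below u v
    rel⇒Below {u} {v} = toWitness {a? = below? u v}

    Below⇒rel : ∀ {u v} → Below u v → T (rel u v)
    Below⇒rel {u} {v} = fromWitness {a? = below? u v}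

    base-close : ∀ {u v} → E (Q ⊠ K r) u v → Close h (pos (proj₁ u)) (pos (proj₁ v))
    base-close (inj₁ (refl , _))     = close-refl
    base-close (inj₂ (inj₁ (_ , e))) = pos-close e
    base-close (inj₂ (inj₂ (e , _))) = pos-close e

    level-close : ∀ {u v} → E X u v → Close h (level u) (level v)
    level-close (inj₁ (refl , _))     = close-refl
    level-close (inj₂ (inj₁ (_ , e))) = base-close e
    level-close (inj₂ (inj₂ (e , _))) = base-close e

    fibre : ∀ {u v} → E X u v → proj₂ u ≡ proj₂ v ⊎ E H (proj₂ u) (proj₂ v)
    fibre (inj₁ (_ , e))          = inj₂ e
    fibre (inj₂ (inj₁ (eq , _)))  = inj₁ eq
    fibre (inj₂ (inj₂ (_ , e)))   = inj₂ e

    same-track : ∀ {x y} → x ≡ y ⊎ E H x y → c x ≡ c y → x ≡ y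
    same-track (inj₁ x≡y) _  = x≡y
    same-track (inj₂ e)   eq = ⊥-elim (indep _ _ e eq)

    -- An edge inside a track would be a loop. Equal residues and levels at most `h < d` apart give
    -- one vertex of `Q`; the `K r` coordinates agree; and since edges of `H` join different tracks
    -- of `H`, the last coordinates agree too.
    track-independent : ∀ u v → E X u v → track u ≢ track v
    track-independent u v e eq with track-injective {u} {v} eq
    ... | p≡q , refl , x≡y
      with pos-injective (close-%⇒≡ (≤-<-trans (m≤m+n h h) 2h<d) p≡q (level-close {u} {v} e))
    ... | refl with same-track (fibre {u} {v} e) x≡y
    ... | refl = Graph.E-irr X {u} e

    rel-total : ∀ u v → track u ≡ track v → T (rel u v) ⊎ u ≡ v ⊎ T (rel v u)
    rel-total u v eq with <-cmp (level u) (level v)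
    ... | tri< lt _ _ = inj₁ (Below⇒rel {u} {v} (inj₁ lt))
    ... | tri> _ _ gt = inj₂ (inj₂ (Below⇒rel {v} {u} (inj₁ gt)))
    ... | tri≈ _ l≡ _ with track-injective {u} {v} eq
    ...   | _ , k≡ , x≡ with total (proj₂ u) (proj₂ v) x≡
    ...     | inj₁ s          = inj₁ (Below⇒rel {u} {v} (inj₂ (l≡ , s)))
    ...     | inj₂ (inj₁ x≡y) = inj₂ (inj₁ (cong₂ _,_ (cong₂ _,_ (pos-injective l≡) k≡) x≡y))
    ...     | inj₂ (inj₂ s)   = inj₂ (inj₂ (Below⇒rel {v} {u} (inj₂ (sym l≡ , s))))

    below-trans : ∀ u v w → track u ≡ track v → track v ≡ track w →
                  Below u v → Below v w → Below u w
    below-trans u v w _ _ (inj₁ p)       (inj₁ q)       = inj₁ (<-trans p q)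
    below-trans u v w _ _ (inj₁ p)       (inj₂ (q , _)) = inj₁ (<-≤-trans p (≤-reflexive q))
    below-trans u v w _ _ (inj₂ (p , _)) (inj₁ q)       = inj₁ (≤-<-trans (≤-reflexive p) q)
    below-trans u v w a b (inj₂ (p , s)) (inj₂ (q , z)) = inj₂ (trans p q ,
      transR _ _ _ (proj₂ (proj₂ (track-injective {u} {v} a)))
                   (proj₂ (proj₂ (track-injective {v} {w} b))) s z)

    -- Stated as equality of cross sums, so that no subtraction occurs.
    same-displacement : ∀ {u u′ v v′} → track u ≡ track u′ → track v ≡ track v′ →
      E X u v → E X u′ v′ → level u + level v′ ≡ level v + level u′
    same-displacement {u} {u′} {v} {v′} a b e e′ = close-%⇒≡ 2h<d
      (trans (%-cong-+ (proj₁ (track-injective {u} {u′} a))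
                       (sym (proj₁ (track-injective {v} {v′} b))))
             (cong (_% d) (+-comm (level u′) (level v))))
      -- Each edge contributes at most `h`, so the cross sums differ by at most `h + h`. This is
      -- what calls for a modulus above `2h`.
      (close-+ (level-close {u} {v} e) (swap (level-close {u′} {v′} e′)))

    -- Different tracks of the product may lie over the same track of `H`, and an edge of the
    -- product may project to a single vertex of `H`, so the argument splits on `c x ≡ c y`.
    no-fibre-crossing : ∀ {x x′ y y′} → c x ≡ c x′ → c y ≡ c y′ →
      x ≡ y ⊎ E H x y → x′ ≡ y′ ⊎ E H x′ y′ → T (R x x′) → ¬ T (R y′ y)
    no-fibre-crossing {x} {x′} {y} {y′} a b e e′ s z with c x Fin.≟ c y
    ... | yes eq
      -- Both edges collapse to vertices here, so `s` and `z` compare the same two vertices in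
      -- opposite directions.
      with same-track e eq | same-track e′ (trans (sym a) (trans eq b))
    ...   | refl | refl = irr x (transR x x′ x a (sym a) s z)
    no-fibre-crossing {x} {x′} {y} {y′} a b (inj₁ refl) e′ s z | no ne = ne refl
    no-fibre-crossing {x} {x′} {y} {y′} a b e (inj₁ refl) s z | no ne =
      ne (trans a (sym b))
    -- With neither edge collapsed, this is a genuine X-crossing in `H`.
    no-fibre-crossing {x} {x′} {y} {y′} a b (inj₂ e) (inj₂ e′) s z | no ne =
      noX x x′ y y′ a b ne e e′ s z

    level-≤ : ∀ {u v} → Below u v → level u ≤ level v
    level-≤ (inj₁ lt)       = <⇒≤ lt
    level-≤ (inj₂ (eq , _)) = ≤-reflexive eq

    no-crossing : ∀ u u′ v v′ → track u ≡ track u′ → track v ≡ track v′ →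
      E X u v → E X u′ v′ → Below u u′ → ¬ Below v′ v
    no-crossing u u′ v v′ a b e e′ (inj₁ p) s =
      -- One strict and one weak inequality of levels add up to
      -- `level u + level v′ < level u′ + level v`, whereas equal displacement makes these sums
      -- equal.
      <-irrefl (trans (same-displacement {u} {u′} {v} {v′} a b e e′) (+-comm (level v) (level u′)))
               (+-mono-<-≤ p (level-≤ {v′} {v} s))
    no-crossing u u′ v v′ a b e e′ (inj₂ (p , _)) (inj₁ q) =
      <-irrefl (trans (same-displacement {u} {u′} {v} {v′} a b e e′) (+-comm (level v) (level u′)))
               (+-mono-≤-< (≤-reflexive p) q)
    no-crossing u u′ v v′ a b e e′ (inj₂ (_ , s)) (inj₂ (_ , z)) = no-fibre-crossing
      (proj₂ (proj₂ (track-injective {u} {u′} a)))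
      (proj₂ (proj₂ (track-injective {v} {v′} b)))
      (fibre {u} {v} e) (fibre {u′} {v′} e′) s z

    below-irrefl : ∀ u → ¬ Below u u
    below-irrefl u (inj₁ lt)      = <-irrefl refl lt
    below-irrefl u (inj₂ (_ , s)) = irr (proj₂ u) s

  Valid-⊠ : ∃[ c′ ] ∃[ R′ ] Valid (Q ⊠ K r ⊠ H) (d * r * t) c′ R′
  Valid-⊠ = track , rel , valid
    track-independent
    (λ u → below-irrefl u ∘ rel⇒Below {u} {u})
    rel-total
    (λ u v w a b s z → Below⇒rel {u} {w}
       (below-trans u v w a b (rel⇒Below {u} {v} s) (rel⇒Below {v} {w} z)))
    (λ u u′ v v′ a b _ e e′ s z →
       no-crossing u u′ v v′ a b e e′ (rel⇒Below {u} {u′} s) (rel⇒Below {v′} {v} z))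

-- Positions along a path and its powers.

walk-close : ∀ (X : Graph) (f : V X → ℕ) → (∀ {u v} → E X u v → Close 1 (f u) (f v)) →
             ∀ {k u v} → Walk X k u v → Close k (f u) (f v)
walk-close X f f-close []      = close-refl
walk-close X f f-close (e ∷ p) = close-trans (f-close e) (walk-close X f f-close p)

pathGraph-close : ∀ {n} {i j : Fin n} → E (pathGraph n) i j → Close 1 (toℕ i) (toℕ j)
pathGraph-close = λ { (inj₁ eq) → suc-close eq ; (inj₂ eq) → swap (suc-close eq) }
  where
  suc-close : ∀ {a b} → b ≡ suc a → Close 1 a b
  suc-close {a} refl = m≤n⇒m≤n+o 1 (n≤1+n a) , ≤-reflexive (+-comm 1 a)

theorem1 : (h r : ℕ) → 1 ≤ h → 1 ≤ r →
    (P H G : Graph) → IsPath P →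
    G ⊆ (P ^ h) ⊠ K r ⊠ H →
    tn G ≤ (2 * h + 1) * r * tn H
theorem1 h r _ _ P H G (n , P≅path) G⊆X =
  -- An optimal layout of `H` is recast as a colouring with one relation on all of `V H`, which
  -- avoids orders on dependent track types.
  let c , R , ok = Layout⇒Valid H (tn H) (proj₁ (tn-isLeast H))
      _ , _ , ok′ = Valid-⊠ {P ^ h} {H} {h} {r} {{>-nonZero (m<n⇒0<n 2h<d)}} 2h<d pos
                      (Injection.injective (↔⇒↣ bijection) ∘ Fin.toℕ-injective) pos-close ok
  -- Minimality of `tn G` is applied to the product layout pulled back to `G`.
  in proj₂ (tn-isLeast G) _ (Valid⇒Layout G _ (Valid-⊆ {G} G⊆X ok′))
  where
  open _≅_ P≅path
  2h<d : h + h < 2 * h + 1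
  2h<d = ≤-reflexive (trans (cong (λ k → suc (h + k)) (sym (+-identityʳ h))) (+-comm 1 (2 * h)))
  pos : V P → ℕ
  pos = toℕ ∘ to
  pos-close : ∀ {p q} → E (P ^ h) p q → Close h (pos p) (pos q)
  pos-close (_ , _ , (w , _) , d≤h) =
    -- The distance in `P` is attained by the walk `w`, whose steps each change the position by at
    -- most one.
    close-mono d≤h (walk-close P pos (pathGraph-close ∘ Equivalence.to edges) w)
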